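{- Let $G$ be a finite group of order $n$. Then $$\operatorname{sdim}(\mathcal{P}_E(G))=n-\max\{|\overline{M}|: M\in\mathcal{M}_G\}=n-\max\{|S|: S\subseteq M \text{ for some } M\in \mathcal{M}_G,\text{ and } \mathcal{M}_x\neq\mathcal{M}_y \text{ for all distinct } x,y\in S\}.$$
   Context: All groups are finite. The enhanced power graph $\mathcal{P}_E(G)$ has vertex set $G$, two distinct vertices $x,y$ being adjacent iff $\langle x,y\rangle$ is cyclic. A maximal cyclic subgroup of $G$ is a cyclic subgroup not properly contained in any cyclic subgroup of $G$; $\mathcal{M}_G$ denotes the set of all maximal cyclic subgroups, and for $g\in G$, $\mathcal{M}_g=\{M\in\mathcal{M}_G: g\in M\}$. For $x,y\in G$ write $x\equiv y$ iff $x$ and $y$ have the same closed neighborhood in $\mathcal{P}_E(G)$ (closed neighborhood $N[x]=\{x\}\cup\{$neighbors of $x\}$); $\overline{x}$ denotes the $\equiv$-class of $x$, and for $M\subseteq G$, $\overline{M}=\{\overline{x}: x\in M\}$ (so $|\overline{M}|$ is the number of $\equiv$-classes meeting $M$). For a graph $\Gamma$ and vertices $x,y,z$, $z$ strongly resolves $x$ and $y$ if there is a shortest path from $z$ to $x$ containing $y$ or a shortest path from $z$ to $y$ containing $x$; a strong resolving set is a vertex set $S$ such that every pair of distinct vertices is strongly resolved by some vertex of $S$; $\operatorname{sdim}(\Gamma)$ is the minimum size of a strong resolving set. -}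

module Defs where

open import Level using (0ℓ)
open import Data.Nat using (ℕ; zero; suc; _≤_; _∸_)
open import Data.Fin using (Fin)
open import Data.Fin.Subset using (Subset; _∈_; _∉_; _⊆_; ∣_∣)
open import Data.Product using (Σ; ∃; ∃-syntax; _×_; _,_)
open import Data.Sum using (_⊎_)
open import Relation.Binary.PropositionalEquality using (_≡_; _≢_)
open import Relation.Nullary using (¬_)
open import Function.Bundles using (_⇔_)
open import Algebra.Structures using (IsGroup)

record FinGroup (n : ℕ) : Set where
  field
    _∙_     : Fin n → Fin n → Fin n
    ε       : Fin n
    _⁻¹     : Fin n → Fin n
    isGroup : IsGroup _≡_ _∙_ ε _⁻¹

module _ {n : ℕ} (G : FinGroup n) where
  open FinGroup G

  pow : Fin n → ℕ → Fin n
  pow g zero    = ε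
  pow g (suc k) = g ∙ pow g k

  data InGen (x y : Fin n) : Fin n → Set where
    gen-x : InGen x y x
    gen-y : InGen x y y
    gen-ε : InGen x y ε
    gen-∙ : ∀ {a b} → InGen x y a → InGen x y b → InGen x y (a ∙ b)
    gen-⁻¹ : ∀ {a} → InGen x y a → InGen x y (a ⁻¹)

  GenCyclic : Fin n → Fin n → Set
  GenCyclic x y = ∃[ z ] (∀ w → InGen x y w ⇔ (∃[ k ] w ≡ pow z k))

  Adj : Fin n → Fin n → Set
  Adj x y = x ≢ y × GenCyclic x y

  InClosedNbhd : Fin n → Fin n → Set
  InClosedNbhd x w = w ≡ x ⊎ Adj x w

  SameNbhd : Fin n → Fin n → Set
  SameNbhd x y = ∀ w → InClosedNbhd x w ⇔ InClosedNbhd y w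

  data Walk : Fin n → Fin n → ℕ → Set where
    [] : ∀ {x} → Walk x x 0
    _∷_ : ∀ {x w y k} → Adj x w → Walk w y k → Walk x y (suc k)

  data OnWalk (v : Fin n) : ∀ {x y k} → Walk x y k → Set where
    here-start : ∀ {y k} {p : Walk v y k} → OnWalk v p
    there : ∀ {x w y k} {a : Adj x w} {p : Walk w y k} →
            OnWalk v p → OnWalk v (a ∷ p)

  -- a shortest path from x to y (a walk of minimum length; such walks are paths)
  IsShortest : ∀ {x y k} → Walk x y k → Set
  IsShortest {x} {y} {k} _ = ∀ {k'} → Walk x y k' → k ≤ k'

  StronglyResolves : Fin n → Fin n → Fin n → Set
  StronglyResolves z x y =
      (∃[ k ] Σ (Walk z x k) (λ p → IsShortest p × OnWalk y p))
    ⊎ (∃[ k ] Σ (Walk z y k) (λ p → IsShortest p × OnWalk x p))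

  IsStrongResolvingSet : Subset n → Set
  IsStrongResolvingSet S =
    ∀ x y → x ≢ y → ∃[ z ] (z ∈ S × StronglyResolves z x y)

  IsSdim : ℕ → Set
  IsSdim k = (∃[ S ] (IsStrongResolvingSet S × ∣ S ∣ ≡ k))
           × (∀ S → IsStrongResolvingSet S → k ≤ ∣ S ∣)

  IsCyclicSubgroup : Subset n → Set
  IsCyclicSubgroup M = ∃[ g ] (∀ x → x ∈ M ⇔ (∃[ k ] x ≡ pow g k))

  IsMaxCyclic : Subset n → Set
  IsMaxCyclic M = IsCyclicSubgroup M
                × (∀ C → IsCyclicSubgroup C → M ⊆ C → C ⊆ M)

  SameMaxCyclics : Fin n → Fin n → Set
  SameMaxCyclics x y = ∀ M → IsMaxCyclic M → (x ∈ M ⇔ y ∈ M)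

  -- |M̄| ≡ j : the ≡-classes meeting M number j, witnessed by a
  -- transversal T ⊆ M containing exactly one element of each such class
  NumClassesIn : Subset n → ℕ → Set
  NumClassesIn M j = ∃[ T ] (T ⊆ M
      × (∀ x y → x ∈ T → y ∈ T → x ≢ y → ¬ SameNbhd x y)
      × (∀ x → x ∈ M → ∃[ t ] (t ∈ T × SameNbhd x t))
      × ∣ T ∣ ≡ j)

  ClassCountValue : ℕ → Set
  ClassCountValue j = ∃[ M ] (IsMaxCyclic M × NumClassesIn M j)

  SeparatedSetValue : ℕ → Set
  SeparatedSetValue j = ∃[ S ] ((∃[ M ] (IsMaxCyclic M × S ⊆ M))
      × (∀ x y → x ∈ S → y ∈ S → x ≢ y → ¬ SameMaxCyclics x y)
      × ∣ S ∣ ≡ j)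

IsMax : (ℕ → Set) → ℕ → Set
IsMax P m = P m × (∀ j → P j → j ≤ m)

{-# OPTIONS --safe #-}
module Submission where

-- The closed neighbourhood of x consists of the w lying with x in a common cyclic subgroup, so
-- x ≡ y iff x and y lie in the same maximal cyclic subgroups, and a largest separated subset of
-- a maximal cyclic M is a transversal of the ≡-classes meeting M.  As ε is adjacent to every
-- other vertex, the graph has diameter at most 2, and S is strong resolving iff distinct
-- vertices outside S are always adjacent and ≡-inequivalent.  It remains to see that a clique lies in
-- a cyclic subgroup.  Adjoining its elements one at a time, this reduces to three pairwise
-- adjacent x, y, z: a generator w of ⟨x, y⟩ must be adjacent to z.  Commuting w and z generate
-- a cyclic group iff wˢ = zᵗ for some coprime s and t; such a relation is found from those for
-- (x, z) and (y, z), because x and y are powers of w with coprime exponents.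

open import Defs
open import Algebra.Bundles using (Group)
import Algebra.Properties.Group as GroupProperties
open import Data.Bool using (true)
open import Data.Empty using (⊥)
open import Data.Fin using (Fin; toℕ; fromℕ<)
open import Data.Fin.Properties using (_≟_; any?; all?; pigeonhole; ¬∀⟶∃¬; toℕ-fromℕ<)
open import Data.Fin.Subset using (Subset; _∈_; _∉_; _⊆_; _∪_; ∁; ⁅_⁆)
  renaming (∣_∣ to card; ⊥ to ⊥ˢ)
open import Data.Fin.Subset.Properties
open import Data.List using ([]; _∷_; allFin)
open import Data.List.Membership.Propositional using () renaming (_∈_ to _∈ᴸ_)
open import Data.List.Membership.Propositional.Properties using (∈-allFin)
open import Data.List.Relation.Unary.Any using (here; there)
open import Data.List.Relation.Unary.All using ([]; _∷_)
open import Data.Nat using (ℕ; zero; suc; _+_; _*_; _∸_; _≤_; _<_; z≤n; s≤s; NonZero; ≢-nonZero)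
open import Data.Nat.Coprimality using (Coprime; coprime-Bézout; coprime-/gcd; gcd≡1⇒coprime)
open import Data.Nat.DivMod using (_/_; _%_; m≡m%n+[m/n]*n; m%n<n; m/n*n≡m)
open import Data.Nat.Divisibility
open import Data.Nat.GCD using (gcd; gcd[m,n]∣m; gcd[m,n]∣n; gcd[m,n]≡0⇒m≡0; gcd[m,n]≡0⇒n≡0;
  module Bézout)
open import Data.Nat.Induction using (<-wellFounded)
open import Data.Nat.Primality using (Prime; prime[2]; ¬prime[1]; prime⇒nonTrivial; euclidsLemma)
open import Data.Nat.Primality.Factorisation using (factorise)
import Data.Nat.Properties as ℕ
open import Data.Product using (∃; ∃₂; ∃-syntax; _×_; _,_; map₂; proj₁; proj₂)
open import Data.Sum using (_⊎_; inj₁; inj₂)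
open import Data.Vec using (tabulate)
open import Data.Vec.Properties using (lookup∘tabulate; []=⇒lookup; lookup⇒[]=)
open import Function using (_∘_)
open import Function.Bundles using (_⇔_; mk⇔; module Equivalence)
open import Function.Construct.Composition using (_⇔-∘_)
open import Function.Construct.Identity using (⇔-id)
open import Function.Construct.Symmetry using (⇔-sym)
open import Induction.WellFounded using (Acc; acc)
open import Relation.Binary.PropositionalEquality
open import Relation.Nullary using (¬_; Dec; yes; no; contradiction)
open import Relation.Nullary.Decidable as Dec using (map′; does; dec-true; ¬?; _×-dec_; _→-dec_)
open import Relation.Unary using (Decidable)

-- Decidability and bounded search.

does⇒ : ∀ {A : Set} (A? : Dec A) → does A? ≡ true → A
does⇒ (yes a) _ = a

least : ∀ {P : ℕ → Set} → Decidable P → ∀ n → P n → ∃[ m ] (P m × (∀ j → P j → m ≤ j))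
least P? zero    p = 0 , p , λ _ _ → z≤n
least {P} P? (suc n) p with P? 0
... | yes p₀ = 0 , p₀ , λ _ _ → z≤n
... | no ¬p₀ with m , pm , m-least ← least (P? ∘ suc) n p = suc m , pm , least′
  where
  least′ : ∀ j → P j → suc m ≤ j
  least′ zero    q = contradiction q ¬p₀
  least′ (suc j) q = s≤s (m-least j q)

maximum : ∀ {P : ℕ → Set} → Decidable P → ∀ b → (∀ j → P j → j ≤ b) → ∃ P → ∃ (IsMax P)
maximum P? b bound (k , p) with P? b
... | yes pb = b , pb , bound
maximum P? zero    bound (k , p) | no ¬p₀ with bound k p
... | z≤n = contradiction p ¬p₀
maximum {P} P? (suc b) bound k,p | no ¬pb = maximum P? b bound′ k,p
  where
  bound′ : ∀ j → P j → j ≤ b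
  bound′ j q = ℕ.≤-pred (ℕ.≤∧≢⇒< (bound j q) λ { refl → ¬pb q })

-- Prime divisors and coprime numbers.

prime-divisor : ∀ n → n ≢ 1 → ∃[ p ] (Prime p × p ∣ n)
prime-divisor zero          n≢1 = 2 , prime[2] , 2 ∣0
prime-divisor (suc zero)    n≢1 = contradiction refl n≢1
prime-divisor n@(suc (suc _)) n≢1 with factorise n
... | record { factors = [] ; isFactorisation = () }
... | record { factors = p ∷ ps ; isFactorisation = eq ; factorsPrime = pr ∷ _ } =
  p , pr , subst (p ∣_) (sym eq) (m∣m*n _)

no-common-prime⇒coprime : ∀ {a b} → (∀ p → Prime p → p ∣ a → p ∣ b → ⊥) → Coprime a b
no-common-prime⇒coprime h {d} (d∣a , d∣b) with d ℕ.≟ 1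
... | yes d≡1 = d≡1
... | no  d≢1 with p , pr , p∣d ← prime-divisor d d≢1 =
  contradiction (∣-trans p∣d d∣b) (h p pr (∣-trans p∣d d∣a))

-- Dividing out of `a` a prime shared with `b` makes `a` smaller, so repeating this ends at a factor
-- `k` coprime to `b`. A prime of `a` either survives in `k` or was divided out, and then it divides
-- `b`.
coprime-part : ∀ a .{{_ : NonZero a}} b →
  ∃[ k ] ((∀ p → Prime p → p ∣ k → p ∣ b → ⊥) × (∀ p → Prime p → p ∣ a → p ∣ b ⊎ p ∣ k))
coprime-part a b = go a (<-wellFounded a)
  where
  go : ∀ a .{{_ : NonZero a}} → Acc _<_ a →
    ∃[ k ] ((∀ p → Prime p → p ∣ k → p ∣ b → ⊥) × (∀ p → Prime p → p ∣ a → p ∣ b ⊎ p ∣ k))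
  go a (acc rs) with gcd a b ℕ.≟ 1
  ... | yes g≡1 = a
    , (λ { p pr p∣a p∣b → ¬prime[1] (subst Prime (gcd≡1⇒coprime g≡1 (p∣a , p∣b)) pr) })
    , λ p pr p∣a → inj₂ p∣a
  ... | no g≢1 with q , qr , q∣g ← prime-divisor (gcd a b) g≢1 = k , k⊥b , cover
    where
    instance _ = prime⇒nonTrivial qr
    q∣a : q ∣ a
    q∣a = ∣-trans q∣g (gcd[m,n]∣m a b)
    instance _ = quotient≢0 q∣a
    rest = go (quotient q∣a) (rs (quotient-< q∣a))
    k = proj₁ rest
    k⊥b = proj₁ (proj₂ rest)
    cover : ∀ p → Prime p → p ∣ a → p ∣ b ⊎ p ∣ k
    cover p pr p∣a
      with euclidsLemma (quotient q∣a) q pr (subst (p ∣_) (m∣n⇒n≡quotient*m q∣a) p∣a)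
    ... | inj₁ p∣rest = proj₂ (proj₂ rest) p pr p∣rest
    ... | inj₂ p∣q    = inj₁ (∣-trans p∣q (∣-trans q∣g (gcd[m,n]∣n a b)))

-- The shift k is divisible by exactly those primes of a that do not divide b.
coprime-shift : ∀ a .{{_ : NonZero a}} b d →
  (∀ p → Prime p → p ∣ a → p ∣ b → p ∣ d → ⊥) → ∃[ k ] Coprime a (b + k * d)
coprime-shift a b d coprime₃ with k , k⊥b , cover ← coprime-part a b =
  k , no-common-prime⇒coprime excluded
  where
  excluded : ∀ p → Prime p → p ∣ a → p ∣ b + k * d → ⊥
  excluded p pr p∣a p∣sum with cover p pr p∣a
  ... | inj₂ p∣k = k⊥b p pr p∣k
    (∣m+n∣m⇒∣n (subst (p ∣_) (ℕ.+-comm b (k * d)) p∣sum) (∣m⇒∣m*n d p∣k))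
  ... | inj₁ p∣b with euclidsLemma k d pr (∣m+n∣m⇒∣n p∣sum p∣b)
  ...   | inj₁ p∣k = k⊥b p pr p∣k p∣b
  ...   | inj₂ p∣d = coprime₃ p pr p∣a p∣b p∣d

-- Both products are the least common multiple of `i` and `j` when the gcd is nonzero. If it is
-- zero, then `i` and `j` both vanish and 1, 1 serve.
coprime-multipliers : ∀ i j → ∃₂ λ s t → Coprime s t × s * i ≡ t * j
coprime-multipliers i j with gcd j i ℕ.≟ 0
... | yes g≡0 = 1 , 1 , (λ (d∣1 , _) → ∣1⇒≡1 d∣1) ,
  cong (1 *_) (trans (gcd[m,n]≡0⇒n≡0 j g≡0) (sym (gcd[m,n]≡0⇒m≡0 g≡0)))
... | no g≢0 = j / g , i / g , coprime-/gcd j i , (begin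
  j / g * i           ≡⟨ cong (j / g *_) (m/n*n≡m (gcd[m,n]∣n j i)) ⟨
  j / g * (i / g * g) ≡⟨ ℕ.*-assoc (j / g) (i / g) g ⟨
  j / g * (i / g) * g ≡⟨ cong (_* g) (ℕ.*-comm (j / g) (i / g)) ⟩
  i / g * (j / g) * g ≡⟨ ℕ.*-assoc (i / g) (j / g) g ⟩
  i / g * (j / g * g) ≡⟨ cong (i / g *_) (m/n*n≡m (gcd[m,n]∣m j i)) ⟩
  i / g * j           ∎)
  where
  open ≡-Reasoning
  g = gcd j i
  instance _ = ≢-nonZero g≢0

-- Powers and cyclic subgroups in a finite group.

module _ {n : ℕ} (G : FinGroup n) where
  open FinGroup G

  group : Group _ _
  group = record { isGroup = isGroup }

  open Group group using (assoc; identityˡ; identityʳ; inverseˡ; inverseʳ)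
  open GroupProperties group using (∙-cancelˡ; ∙-cancelʳ)
  open ≡-Reasoning

  infix 4 _∈⟨_⟩ _commutes-with_
  _∈⟨_⟩ : Fin n → Fin n → Set
  x ∈⟨ g ⟩ = ∃[ k ] x ≡ pow G g k

  _commutes-with_ : Fin n → Fin n → Set
  x commutes-with y = x ∙ y ≡ y ∙ x

  pow-ε : ∀ k → pow G ε k ≡ ε
  pow-ε zero    = refl
  pow-ε (suc k) = trans (identityˡ _) (pow-ε k)

  pow-1 : ∀ g → pow G g 1 ≡ g
  pow-1 = identityʳ

  pow-+ : ∀ g j k → pow G g (j + k) ≡ pow G g j ∙ pow G g k
  pow-+ g zero    k = sym (identityˡ _)
  pow-+ g (suc j) k = trans (cong (g ∙_) (pow-+ g j k)) (sym (assoc _ _ _))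

  pow-* : ∀ g j k → pow G g (j * k) ≡ pow G (pow G g k) j
  pow-* g zero    k = refl
  pow-* g (suc j) k = trans (pow-+ g k (j * k)) (cong (pow G g k ∙_) (pow-* g j k))

  commutes-pow : ∀ {x y} → x commutes-with y → ∀ k → x commutes-with pow G y k
  commutes-pow c zero = trans (identityʳ _) (sym (identityˡ _))
  commutes-pow {x} {y} c (suc k) = begin
    x ∙ (y ∙ pow G y k) ≡⟨ assoc _ _ _ ⟨
    (x ∙ y) ∙ pow G y k ≡⟨ cong (_∙ pow G y k) c ⟩
    (y ∙ x) ∙ pow G y k ≡⟨ assoc _ _ _ ⟩
    y ∙ (x ∙ pow G y k) ≡⟨ cong (y ∙_) (commutes-pow c k) ⟩
    y ∙ (pow G y k ∙ x) ≡⟨ assoc _ _ _ ⟨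
    (y ∙ pow G y k) ∙ x ∎

  pow-∙ : ∀ {x y} → x commutes-with y → ∀ k → pow G (x ∙ y) k ≡ pow G x k ∙ pow G y k
  pow-∙ c zero = sym (identityˡ _)
  pow-∙ {x} {y} c (suc k) = begin
    (x ∙ y) ∙ pow G (x ∙ y) k         ≡⟨ cong ((x ∙ y) ∙_) (pow-∙ c k) ⟩
    (x ∙ y) ∙ (pow G x k ∙ pow G y k) ≡⟨ assoc _ _ _ ⟩
    x ∙ (y ∙ (pow G x k ∙ pow G y k)) ≡⟨ cong (x ∙_) (assoc _ _ _) ⟨
    x ∙ ((y ∙ pow G x k) ∙ pow G y k) ≡⟨ cong (λ u → x ∙ (u ∙ pow G y k)) (commutes-pow (sym c) k) ⟩
    x ∙ ((pow G x k ∙ y) ∙ pow G y k) ≡⟨ cong (x ∙_) (assoc _ _ _) ⟩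
    x ∙ (pow G x k ∙ (y ∙ pow G y k)) ≡⟨ assoc _ _ _ ⟨
    (x ∙ pow G x k) ∙ (y ∙ pow G y k) ∎

  -- Two of the n + 1 powers with exponents 0 to n coincide, and cancelling the lower one leaves a
  -- positive exponent. The successor in the statement records positivity.
  finite-order : ∀ g → ∃[ m ] pow G g (suc m) ≡ ε
  finite-order g with i , j , i<j , eq ← pigeonhole (ℕ.n<1+n n) (λ i → pow G g (toℕ i)) =
    toℕ j ∸ suc (toℕ i) , ∙-cancelˡ (pow G g (toℕ i)) _ _ (begin
      pow G g (toℕ i) ∙ pow G g (suc (toℕ j ∸ suc (toℕ i))) ≡⟨ pow-+ g (toℕ i) _ ⟨
      pow G g (toℕ i + suc (toℕ j ∸ suc (toℕ i)))           ≡⟨ cong (pow G g) (ℕ.+-suc (toℕ i) _) ⟩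
      pow G g (suc (toℕ i) + (toℕ j ∸ suc (toℕ i)))         ≡⟨ cong (pow G g) (ℕ.m+[n∸m]≡n i<j) ⟩
      pow G g (toℕ j)                                       ≡⟨ eq ⟨
      pow G g (toℕ i)                                       ≡⟨ identityʳ _ ⟨
      pow G g (toℕ i) ∙ ε                                   ∎)

  self∈⟨⟩ : ∀ g → g ∈⟨ g ⟩
  self∈⟨⟩ g = 1 , sym (pow-1 g)

  ε∈⟨⟩ : ∀ g → ε ∈⟨ g ⟩
  ε∈⟨⟩ g = 0 , refl

  ∙∈⟨⟩ : ∀ {g x y} → x ∈⟨ g ⟩ → y ∈⟨ g ⟩ → x ∙ y ∈⟨ g ⟩
  ∙∈⟨⟩ {g} (j , refl) (k , refl) = j + k , sym (pow-+ g j k)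

  pow∈⟨⟩ : ∀ {g x} → x ∈⟨ g ⟩ → ∀ k → pow G x k ∈⟨ g ⟩
  pow∈⟨⟩ {g} (j , refl) k = k * j , sym (pow-* g k j)

  ⟨⟩-trans : ∀ {x y z} → x ∈⟨ y ⟩ → y ∈⟨ z ⟩ → x ∈⟨ z ⟩
  ⟨⟩-trans (k , refl) y∈ = pow∈⟨⟩ y∈ k

  ⁻¹∈⟨⟩ : ∀ {g x} → x ∈⟨ g ⟩ → x ⁻¹ ∈⟨ g ⟩
  ⁻¹∈⟨⟩ {g} {x} x∈ with m , eq ← finite-order x =
    -- As `x` to the power `suc m` is `ε`, the inverse of `x` is its m-th power.
    subst (_∈⟨ g ⟩) (∙-cancelˡ x _ _ (trans eq (sym (inverseʳ x)))) (pow∈⟨⟩ x∈ m)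

  ∈⟨⟩-cancelʳ : ∀ {g x y} → x ∙ y ∈⟨ g ⟩ → y ∈⟨ g ⟩ → x ∈⟨ g ⟩
  ∈⟨⟩-cancelʳ {g} {x} {y} xy∈ y∈ = subst (_∈⟨ g ⟩)
    (begin
      (x ∙ y) ∙ (y ⁻¹) ≡⟨ assoc _ _ _ ⟩
      x ∙ (y ∙ (y ⁻¹)) ≡⟨ cong (x ∙_) (inverseʳ y) ⟩
      x ∙ ε            ≡⟨ identityʳ x ⟩
      x              ∎)
    (∙∈⟨⟩ xy∈ (⁻¹∈⟨⟩ y∈))

  infix 4 _∈⟨_⟩?
  -- Exponents matter only modulo the positive exponent `suc m` that kills `g`, which leaves a
  -- finite search.
  _∈⟨_⟩? : ∀ x g → Dec (x ∈⟨ g ⟩)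
  x ∈⟨ g ⟩? with m , eq ← finite-order g =
    map′ (λ (i , e) → toℕ i , e)
         (λ (k , e) → fromℕ< (m%n<n k (suc m)) , trans e (trans (reduce k)
           (cong (pow G g) (sym (toℕ-fromℕ< (m%n<n k (suc m)))))))
         (any? λ (i : Fin (suc m)) → x ≟ pow G g (toℕ i))
    where
    reduce : ∀ k → pow G g k ≡ pow G g (k % suc m)
    reduce k = begin
      pow G g k                             ≡⟨ cong (pow G g) (m≡m%n+[m/n]*n k (suc m)) ⟩
      pow G g (r + q * suc m)               ≡⟨ pow-+ g r _ ⟩
      pow G g r ∙ pow G g (q * suc m)       ≡⟨ cong (pow G g r ∙_) (pow-* g q (suc m)) ⟩
      pow G g r ∙ pow G (pow G g (suc m)) q ≡⟨ cong (λ u → pow G g r ∙ pow G u q) eq ⟩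
      pow G g r ∙ pow G ε q                 ≡⟨ cong (pow G g r ∙_) (pow-ε q) ⟩
      pow G g r ∙ ε                         ≡⟨ identityʳ _ ⟩
      pow G g r                             ∎
      where
      r = k % suc m
      q = k / suc m

  -- The remainder of a valid exponent on division by the least positive one is again valid, hence
  -- zero. For `z` equal to `ε` the least exponent is the order of `w`.
  least-exponent : ∀ w z → ∃[ a ] (pow G w (suc a) ∈⟨ z ⟩ × (∀ s → pow G w s ∈⟨ z ⟩ → suc a ∣ s))
  least-exponent w z with m , w^1+m≡ε ← finite-order w
    with a′ , w^a∈ , a-least ← least (λ k → pow G w (suc k) ∈⟨ z ⟩?) m (0 , w^1+m≡ε) =
    a′ , w^a∈ , divides-all
    where
    a = suc a′
    divides-all : ∀ s → pow G w s ∈⟨ z ⟩ → a ∣ s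
    divides-all s w^s∈ = m%n≡0⇒n∣m s a (remainder≡0 (s % a) (m%n<n s a) remainder∈)
      where
      remainder∈ : pow G w (s % a) ∈⟨ z ⟩
      remainder∈ = ∈⟨⟩-cancelʳ
        (subst (_∈⟨ z ⟩) (trans (cong (pow G w) (m≡m%n+[m/n]*n s a)) (pow-+ w (s % a) _)) w^s∈)
        (subst (_∈⟨ z ⟩) (sym (pow-* w (s / a) a)) (pow∈⟨⟩ w^a∈ (s / a)))
      remainder≡0 : ∀ r → r < a → pow G w r ∈⟨ z ⟩ → r ≡ 0
      remainder≡0 zero    _   _    = refl
      remainder≡0 (suc r) r<a w^r∈ =
        contradiction (ℕ.<-≤-trans (ℕ.≤-pred r<a) (a-least r w^r∈)) (ℕ.n≮n r)

  -- Pairs in a common cyclic subgroup and their common roots.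

  -- A reflexive and decidable substitute for `GenCyclic`: the cyclic subgroup may be larger than
  -- the one generated by `x` and `y`.
  CoCyclic : Fin n → Fin n → Set
  CoCyclic x y = ∃[ z ] (x ∈⟨ z ⟩ × y ∈⟨ z ⟩)

  coCyclic-sym : ∀ {x y} → CoCyclic x y → CoCyclic y x
  coCyclic-sym (z , x∈ , y∈) = z , y∈ , x∈

  coCyclic⇒commutes : ∀ {x y} → CoCyclic x y → x commutes-with y
  coCyclic⇒commutes (z , (j , refl) , (k , refl)) =
    trans (sym (pow-+ z j k)) (trans (cong (pow G z) (ℕ.+-comm j k)) (pow-+ z k j))

  gen-pow : ∀ {x y w} → InGen G x y w → ∀ k → InGen G x y (pow G w k)
  gen-pow w∈ zero    = gen-ε
  gen-pow w∈ (suc k) = gen-∙ w∈ (gen-pow w∈ k)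

  gen-swap : ∀ {x y w} → InGen G x y w → InGen G y x w
  gen-swap gen-x         = gen-y
  gen-swap gen-y         = gen-x
  gen-swap gen-ε         = gen-ε
  gen-swap (gen-∙ a b)   = gen-∙ (gen-swap a) (gen-swap b)
  gen-swap (gen-⁻¹ a)    = gen-⁻¹ (gen-swap a)

  gen⊆⟨⟩ : ∀ {x y z w} → x ∈⟨ z ⟩ → y ∈⟨ z ⟩ → InGen G x y w → w ∈⟨ z ⟩
  gen⊆⟨⟩ x∈ y∈ gen-x       = x∈
  gen⊆⟨⟩ x∈ y∈ gen-y       = y∈
  gen⊆⟨⟩ x∈ y∈ gen-ε       = ε∈⟨⟩ _
  gen⊆⟨⟩ x∈ y∈ (gen-∙ a b) = ∙∈⟨⟩ (gen⊆⟨⟩ x∈ y∈ a) (gen⊆⟨⟩ x∈ y∈ b)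
  gen⊆⟨⟩ x∈ y∈ (gen-⁻¹ a)  = ⁻¹∈⟨⟩ (gen⊆⟨⟩ x∈ y∈ a)

  commutes-gen : ∀ {x y z w} → z commutes-with x → z commutes-with y →
    InGen G x y w → z commutes-with w
  commutes-gen zx zy gen-x = zx
  commutes-gen zx zy gen-y = zy
  commutes-gen zx zy gen-ε = trans (identityʳ _) (sym (identityˡ _))
  commutes-gen {z = z} zx zy (gen-∙ {a} {b} p q) = begin
    z ∙ (a ∙ b) ≡⟨ assoc _ _ _ ⟨
    (z ∙ a) ∙ b ≡⟨ cong (_∙ b) (commutes-gen zx zy p) ⟩
    (a ∙ z) ∙ b ≡⟨ assoc _ _ _ ⟩
    a ∙ (z ∙ b) ≡⟨ cong (a ∙_) (commutes-gen zx zy q) ⟩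
    a ∙ (b ∙ z) ≡⟨ assoc _ _ _ ⟨
    (a ∙ b) ∙ z ∎
  commutes-gen {z = z} zx zy (gen-⁻¹ {a} p) with k , a⁻¹≡a^k ← ⁻¹∈⟨⟩ (self∈⟨⟩ a) =
    subst (z commutes-with_) (sym a⁻¹≡a^k) (commutes-pow (commutes-gen zx zy p) k)

  -- With u s − v t = 1, the root c = yᵘ x⁻ᵛ satisfies cᵗ = x^(us−vt) and cˢ = y^(us−vt).
  bézout⇒common-root : ∀ {x y} s t u v → x commutes-with y → 1 + v * t ≡ u * s →
    pow G x s ≡ pow G y t → ∃[ c ] (InGen G x y c × x ≡ pow G c t × y ≡ pow G c s)
  bézout⇒common-root {x} {y} s t u v xy bézout x^s≡y^t = c , c∈ , x≡c^t , y≡c^s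
    where
    c = pow G y u ∙ (pow G x v ⁻¹)

    c∈ : InGen G x y c
    c∈ = gen-∙ (gen-pow gen-y u) (gen-⁻¹ (gen-pow gen-x v))

    c∙x^v≡y^u : c ∙ pow G x v ≡ pow G y u
    c∙x^v≡y^u = trans (assoc _ _ _) (trans (cong (pow G y u ∙_) (inverseˡ _)) (identityʳ _))

    c-x^v : c commutes-with pow G x v
    c-x^v = commutes-pow (sym (commutes-gen refl xy c∈)) v

    c^k∙x^kv≡y^ku : ∀ k → pow G c k ∙ pow G x (k * v) ≡ pow G y (k * u)
    c^k∙x^kv≡y^ku k = begin
      pow G c k ∙ pow G x (k * v)     ≡⟨ cong (pow G c k ∙_) (pow-* x k v) ⟩
      pow G c k ∙ pow G (pow G x v) k ≡⟨ pow-∙ c-x^v k ⟨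
      pow G (c ∙ pow G x v) k         ≡⟨ cong (λ w → pow G w k) c∙x^v≡y^u ⟩
      pow G (pow G y u) k             ≡⟨ pow-* y k u ⟨
      pow G y (k * u)                 ∎

    x^js≡y^jt : ∀ j → pow G x (j * s) ≡ pow G y (j * t)
    x^js≡y^jt j = trans (pow-* x j s) (trans (cong (λ w → pow G w j) x^s≡y^t) (sym (pow-* y j t)))

    x≡c^t : x ≡ pow G c t
    x≡c^t = ∙-cancelʳ (pow G x (t * v)) _ _ (begin
      x ∙ pow G x (t * v)         ≡⟨ cong (λ e → pow G x (1 + e)) (ℕ.*-comm t v) ⟩
      pow G x (1 + v * t)         ≡⟨ cong (pow G x) bézout ⟩
      pow G x (u * s)             ≡⟨ x^js≡y^jt u ⟩
      pow G y (u * t)             ≡⟨ cong (pow G y) (ℕ.*-comm u t) ⟩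
      pow G y (t * u)             ≡⟨ c^k∙x^kv≡y^ku t ⟨
      pow G c t ∙ pow G x (t * v) ∎)

    y≡c^s : y ≡ pow G c s
    y≡c^s = ∙-cancelʳ (pow G x (s * v)) _ _ (begin
      y ∙ pow G x (s * v)         ≡⟨ cong (λ e → y ∙ pow G x e) (ℕ.*-comm s v) ⟩
      y ∙ pow G x (v * s)         ≡⟨ cong (y ∙_) (x^js≡y^jt v) ⟩
      pow G y (1 + v * t)         ≡⟨ cong (pow G y) bézout ⟩
      pow G y (u * s)             ≡⟨ cong (pow G y) (ℕ.*-comm u s) ⟩
      pow G y (s * u)             ≡⟨ c^k∙x^kv≡y^ku s ⟨
      pow G c s ∙ pow G x (s * v) ∎)

  -- Over the natural numbers Bézout's identity has two forms, according to which product is the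
  -- larger. Exchanging `x` and `y` turns the second into the first.
  coprime⇒common-root : ∀ {x y} s t → x commutes-with y → Coprime s t →
    pow G x s ≡ pow G y t → ∃[ c ] (InGen G x y c × x ≡ pow G c t × y ≡ pow G c s)
  coprime⇒common-root s t xy s⊥t eq with coprime-Bézout s⊥t
  ... | Bézout.+- u v bézout = bézout⇒common-root s t u v xy bézout eq
  ... | Bézout.-+ u v bézout
    with c , c∈ , y≡ , x≡ ← bézout⇒common-root t s v u (sym xy) bézout (sym eq) =
    c , gen-swap c∈ , x≡ , y≡

  coCyclic⇒coprime-relation : ∀ {x y} → CoCyclic x y →
    ∃₂ λ s t → Coprime s t × pow G x s ≡ pow G y t
  coCyclic⇒coprime-relation (z , (i , refl) , (j , refl))
    with s , t , s⊥t , si≡tj ← coprime-multipliers i j = s , t , s⊥t , (begin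
    pow G (pow G z i) s ≡⟨ pow-* z s i ⟨
    pow G z (s * i)     ≡⟨ cong (pow G z) si≡tj ⟩
    pow G z (t * j)     ≡⟨ pow-* z t j ⟩
    pow G (pow G z j) t ∎)

  -- Since `c` lies in ⟨x, y⟩ and has both `x` and `y` as powers, it generates ⟨x, y⟩. The
  -- coprimality of the two exponents is what later lets relations for `x` and `y` be transferred to
  -- `c`.
  coCyclic⇒common-root : ∀ {x y} → CoCyclic x y →
    ∃[ c ] (InGen G x y c × ∃₂ λ s t → Coprime s t × x ≡ pow G c t × y ≡ pow G c s)
  coCyclic⇒common-root xy with s , t , s⊥t , eq ← coCyclic⇒coprime-relation xy
    with c , c∈ , x≡ , y≡ ← coprime⇒common-root s t (coCyclic⇒commutes xy) s⊥t eq =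
    c , c∈ , s , t , s⊥t , x≡ , y≡

  -- Joining pairwise adjacent elements in one cyclic subgroup.

  -- A relation (wʳ)ˢ = zᵗ with coprime s and t has sr = qa for some q, and t is congruent to qb
  -- modulo the order `suc m` of `z`. So p divides both sr and t; it cannot divide s as well, hence
  -- it divides r.
  prime∣exponent : ∀ {w z a b m p} →
    pow G w a ≡ pow G z b → (∀ s → pow G w s ∈⟨ z ⟩ → a ∣ s) →
    pow G z (suc m) ≡ ε → (∀ s → pow G z s ∈⟨ ε ⟩ → suc m ∣ s) →
    Prime p → p ∣ a → p ∣ b → p ∣ suc m →
    ∀ r → CoCyclic (pow G w r) z → p ∣ r
  prime∣exponent {w} {z} {a} {b} {m} {p} w^a≡z^b a-least z^m≡ε m-least pr p∣a p∣b p∣m r wr-z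
    with s , t , s⊥t , w^rs≡z^t ← coCyclic⇒coprime-relation wr-z
    with divides q sr≡qa ← a-least (s * r) (t , trans (pow-* w s r) w^rs≡z^t)
    with euclidsLemma s r pr (∣-trans p∣a (divides q sr≡qa))
  ... | inj₂ p∣r = p∣r
  ... | inj₁ p∣s = contradiction (subst Prime (s⊥t (p∣s , p∣t)) pr) ¬prime[1]
    where
    z^t≡z^qb : pow G z t ≡ pow G z (q * b)
    z^t≡z^qb = begin
      pow G z t           ≡⟨ w^rs≡z^t ⟨
      pow G (pow G w r) s ≡⟨ pow-* w s r ⟨
      pow G w (s * r)     ≡⟨ cong (pow G w) sr≡qa ⟩
      pow G w (q * a)     ≡⟨ pow-* w q a ⟩
      pow G (pow G w a) q ≡⟨ cong (λ u → pow G u q) w^a≡z^b ⟩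
      pow G (pow G z b) q ≡⟨ pow-* z q b ⟨
      pow G z (q * b)     ∎

    -- Modulo `suc m` the factor `m` acts as -1, so this exponent stands for t - qb without
    -- subtraction.
    z^[mqb+t]≡ε : pow G z (m * (q * b) + t) ≡ ε
    z^[mqb+t]≡ε = begin
      pow G z (m * (q * b) + t)               ≡⟨ pow-+ z (m * (q * b)) t ⟩
      pow G z (m * (q * b)) ∙ pow G z t       ≡⟨ cong (pow G z (m * (q * b)) ∙_) z^t≡z^qb ⟩
      pow G z (m * (q * b)) ∙ pow G z (q * b) ≡⟨ pow-+ z (m * (q * b)) (q * b) ⟨
      pow G z (m * (q * b) + q * b)           ≡⟨ cong (pow G z) (ℕ.+-comm _ (q * b)) ⟩
      pow G z (suc m * (q * b))               ≡⟨ cong (pow G z) (ℕ.*-comm (suc m) (q * b)) ⟩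
      pow G z (q * b * suc m)                 ≡⟨ pow-* z (q * b) (suc m) ⟩
      pow G (pow G z (suc m)) (q * b)         ≡⟨ cong (λ u → pow G u (q * b)) z^m≡ε ⟩
      pow G ε (q * b)                         ≡⟨ pow-ε (q * b) ⟩
      ε                                       ∎

    p∣t : p ∣ t
    p∣t = ∣m+n∣m⇒∣n (∣-trans p∣m (m-least _ (0 , z^[mqb+t]≡ε))) (∣n⇒∣m*n m (∣n⇒∣m*n q p∣b))

  -- All relations wʳ = zᵗ follow from wᵃ = zᵇ and zᵐ = 1, so the hypotheses leave a, b and m
  -- without common prime, and then some relation wᵃ = z^(b + km) has coprime exponents.
  coprime-powers⇒coCyclic : ∀ {w z} s t → Coprime s t → w commutes-with z →
    CoCyclic (pow G w s) z → CoCyclic (pow G w t) z → CoCyclic w z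
  coprime-powers⇒coCyclic {w} {z} s t s⊥t wz ws-z wt-z =
    combine (least-exponent w z) (least-exponent z ε)
    where
    combine : ∃[ a ] (pow G w (suc a) ∈⟨ z ⟩ × (∀ s → pow G w s ∈⟨ z ⟩ → suc a ∣ s)) →
              ∃[ m ] (pow G z (suc m) ∈⟨ ε ⟩ × (∀ s → pow G z s ∈⟨ ε ⟩ → suc m ∣ s)) →
              CoCyclic w z
    combine (a′ , (b , w^a≡z^b) , a-least) (m′ , (l , z^m≡ε^l) , m-least) =
      coprime-relation (coprime-shift a b m no-common-prime)
      where
      a = suc a′
      m = suc m′

      z^m≡ε : pow G z m ≡ ε
      z^m≡ε = trans z^m≡ε^l (pow-ε l)

      no-common-prime : ∀ p → Prime p → p ∣ a → p ∣ b → p ∣ m → ⊥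
      no-common-prime p pr p∣a p∣b p∣m =
        ¬prime[1] (subst Prime (s⊥t (divides-exp s ws-z , divides-exp t wt-z)) pr)
        where
        divides-exp : ∀ r → CoCyclic (pow G w r) z → p ∣ r
        divides-exp = prime∣exponent w^a≡z^b a-least z^m≡ε m-least pr p∣a p∣b p∣m

      coprime-relation : ∃[ k ] Coprime a (b + k * m) → CoCyclic w z
      coprime-relation (k , a⊥b+km) =
        let c , _ , w≡ , z≡ = coprime⇒common-root a (b + k * m) wz a⊥b+km w^a≡z^[b+km]
        in c , (b + k * m , w≡) , (a , z≡)
        where
        w^a≡z^[b+km] : pow G w a ≡ pow G z (b + k * m)
        w^a≡z^[b+km] = begin
          pow G w a                       ≡⟨ w^a≡z^b ⟩
          pow G z b                       ≡⟨ identityʳ _ ⟨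
          pow G z b ∙ ε                   ≡⟨ cong (pow G z b ∙_) (pow-ε k) ⟨
          pow G z b ∙ pow G ε k           ≡⟨ cong (λ u → pow G z b ∙ pow G u k) z^m≡ε ⟨
          pow G z b ∙ pow G (pow G z m) k ≡⟨ cong (pow G z b ∙_) (pow-* z k m) ⟨
          pow G z b ∙ pow G z (k * m)     ≡⟨ pow-+ z b _ ⟨
          pow G z (b + k * m)             ∎

  -- The common root of `x` and `y` serves as `c`: its powers `x` and `y` have coprime exponents, so
  -- being co-cyclic with `z` passes from both of them to `c`.
  coCyclic-join : ∀ {x y} → CoCyclic x y →
    ∃[ c ] (x ∈⟨ c ⟩ × y ∈⟨ c ⟩ × (∀ z → CoCyclic x z → CoCyclic y z → CoCyclic c z))
  coCyclic-join {x} {y} xy with c , c∈ , s , t , s⊥t , x≡c^t , y≡c^s ← coCyclic⇒common-root xy =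
    c , (t , x≡c^t) , (s , y≡c^s) , λ z xz yz →
      coprime-powers⇒coCyclic s t s⊥t
        -- An element commuting with `x` and `y` commutes with all of ⟨x, y⟩, which contains `c`.
        (sym (commutes-gen (sym (coCyclic⇒commutes xz)) (sym (coCyclic⇒commutes yz)) c∈))
        (subst (λ u → CoCyclic u z) y≡c^s yz)
        (subst (λ u → CoCyclic u z) x≡c^t xz)

  -- Starting from `ε`, a generator is enlarged to absorb the elements of `T` one by one. The
  -- invariant is that it stays co-cyclic with every element of `T`, which `coCyclic-join`
  -- preserves.
  clique⇒⊆⟨⟩ : (T : Subset n) → (∀ x y → x ∈ T → y ∈ T → CoCyclic x y) →
    ∃[ d ] (∀ x → x ∈ T → x ∈⟨ d ⟩)
  clique⇒⊆⟨⟩ T clique =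
    let d , _ , _ , T⊆ = absorb (allFin n) ε (λ x x∈T → x , ε∈⟨⟩ x , self∈⟨⟩ x)
    in d , λ x x∈T → T⊆ x (∈-allFin x) x∈T
    where
    absorb : ∀ L c → (∀ x → x ∈ T → CoCyclic c x) →
      ∃[ d ] (c ∈⟨ d ⟩ × (∀ x → x ∈ T → CoCyclic d x) × (∀ x → x ∈ᴸ L → x ∈ T → x ∈⟨ d ⟩))
    absorb [] c c-T = c , self∈⟨⟩ c , c-T , λ _ ()
    absorb (y ∷ L) c c-T with y ∈? T
    ... | no y∉T =
      let d , c∈ , d-T , L∈ = absorb L c c-T
      in d , c∈ , d-T , λ { _ (here refl) y∈T → contradiction y∈T y∉T
                          ; x (there x∈L) x∈T    → L∈ x x∈L x∈T }
    ... | yes y∈T =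
      let c′ , c∈c′ , y∈c′ , join = coCyclic-join (c-T y y∈T)
          d , c′∈ , d-T , L∈ = absorb L c′ (λ x x∈T → join x (c-T x x∈T) (clique y x y∈T x∈T))
      in d , ⟨⟩-trans c∈c′ c′∈ , d-T ,
         λ { _ (here refl) _ → ⟨⟩-trans y∈c′ c′∈ ; x (there x∈L) x∈T → L∈ x x∈L x∈T }

  -- Closed neighbourhoods and the relation ≡.

  coCyclic⇔genCyclic : ∀ {x y} → CoCyclic x y ⇔ GenCyclic G x y
  coCyclic⇔genCyclic {x} {y} = mk⇔ to from
    where
    to : CoCyclic x y → GenCyclic G x y
    to xy with c , c∈ , s , t , _ , x≡c^t , y≡c^s ← coCyclic⇒common-root xy =
      c , λ w → mk⇔ (gen⊆⟨⟩ (t , x≡c^t) (s , y≡c^s)) λ { (k , refl) → gen-pow c∈ k }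
    from : GenCyclic G x y → CoCyclic x y
    from (z , gen⇔) = z , Equivalence.to (gen⇔ x) gen-x , Equivalence.to (gen⇔ y) gen-y

  coCyclic? : ∀ x y → Dec (CoCyclic x y)
  coCyclic? x y = any? λ z → x ∈⟨ z ⟩? ×-dec y ∈⟨ z ⟩?

  coCyclic-refl : ∀ x → CoCyclic x x
  coCyclic-refl x = x , self∈⟨⟩ x , self∈⟨⟩ x

  coCyclic-ε : ∀ x → CoCyclic x ε
  coCyclic-ε x = x , self∈⟨⟩ x , ε∈⟨⟩ x

  coCyclic⇒adj : ∀ {x y} → x ≢ y → CoCyclic x y → Adj G x y
  coCyclic⇒adj x≢y xy = x≢y , Equivalence.to coCyclic⇔genCyclic xy

  adj⇒coCyclic : ∀ {x y} → Adj G x y → CoCyclic x y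
  adj⇒coCyclic (_ , xy) = Equivalence.from coCyclic⇔genCyclic xy

  closedNbhd⇔coCyclic : ∀ {x w} → InClosedNbhd G x w ⇔ CoCyclic x w
  closedNbhd⇔coCyclic {x} {w} = mk⇔ to from
    where
    to : InClosedNbhd G x w → CoCyclic x w
    to (inj₁ refl) = coCyclic-refl x
    to (inj₂ adj)  = adj⇒coCyclic adj
    from : CoCyclic x w → InClosedNbhd G x w
    from xw with w ≟ x
    ... | yes w≡x = inj₁ w≡x
    ... | no  w≢x = inj₂ (coCyclic⇒adj (w≢x ∘ sym) xw)

  sameNbhd⇔ : ∀ {x y} → SameNbhd G x y ⇔ (∀ w → CoCyclic x w ⇔ CoCyclic y w)
  sameNbhd⇔ = mk⇔
    (λ same w → closedNbhd⇔coCyclic ⇔-∘ (same w ⇔-∘ ⇔-sym closedNbhd⇔coCyclic))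
    (λ same w → ⇔-sym closedNbhd⇔coCyclic ⇔-∘ (same w ⇔-∘ closedNbhd⇔coCyclic))

  sameNbhd-sym : ∀ {x y} → SameNbhd G x y → SameNbhd G y x
  sameNbhd-sym same w = ⇔-sym (same w)

  coCyclic⇔? : ∀ x y w → Dec (CoCyclic x w ⇔ CoCyclic y w)
  coCyclic⇔? x y w = map′ (λ (f , g) → mk⇔ f g) (λ e → Equivalence.to e , Equivalence.from e)
    ((coCyclic? x w →-dec coCyclic? y w) ×-dec (coCyclic? y w →-dec coCyclic? x w))

  sameNbhd? : ∀ x y → Dec (SameNbhd G x y)
  sameNbhd? x y = Dec.map (⇔-sym sameNbhd⇔) (all? (coCyclic⇔? x y))

  distinguish : ∀ {x y} → ¬ SameNbhd G x y →
    ∃[ w ] ((CoCyclic x w × ¬ CoCyclic y w) ⊎ (CoCyclic y w × ¬ CoCyclic x w))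
  distinguish {x} {y} x≢y
    with w , ¬same ← ¬∀⟶∃¬ n _ (coCyclic⇔? x y) (x≢y ∘ Equivalence.from sameNbhd⇔)
    with coCyclic? x w | coCyclic? y w
  ... | yes xw | yes yw = contradiction (mk⇔ (λ _ → yw) (λ _ → xw)) ¬same
  ... | yes xw | no ¬yw = w , inj₁ (xw , ¬yw)
  ... | no ¬xw | yes yw = w , inj₂ (yw , ¬xw)
  ... | no ¬xw | no ¬yw = contradiction
    (mk⇔ (λ xw → contradiction xw ¬xw) (λ yw → contradiction yw ¬yw)) ¬same

  -- Maximal cyclic subgroups.

  ⟨_⟩ : Fin n → Subset n
  ⟨ g ⟩ = tabulate λ x → does (x ∈⟨ g ⟩?)

  ∈⟨⟩⇔∈ : ∀ {g x} → x ∈ ⟨ g ⟩ ⇔ x ∈⟨ g ⟩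
  ∈⟨⟩⇔∈ {g} {x} = mk⇔ to from
    where
    to : x ∈ ⟨ g ⟩ → x ∈⟨ g ⟩
    to x∈ = does⇒ (x ∈⟨ g ⟩?) (trans (sym (lookup∘tabulate _ x)) ([]=⇒lookup x∈))
    from : x ∈⟨ g ⟩ → x ∈ ⟨ g ⟩
    from x∈g = lookup⇒[]= x ⟨ g ⟩ (trans (lookup∘tabulate _ x) (dec-true (x ∈⟨ g ⟩?) x∈g))

  -- Among the cyclic subgroups containing `g`, one of largest cardinality is maximal, as any proper
  -- cyclic overgroup would be larger.
  cyclic⊆maximal : ∀ g → ∃[ M ] (IsMaxCyclic G M × (∀ x → x ∈⟨ g ⟩ → x ∈ M))
  cyclic⊆maximal g
    with _ , (h , g∈h , refl) , largest ← maximum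
      {P = λ k → ∃[ h ] (g ∈⟨ h ⟩ × card ⟨ h ⟩ ≡ k)}
      (λ k → any? λ h → g ∈⟨ h ⟩? ×-dec (card ⟨ h ⟩ ℕ.≟ k))
      n (λ { _ (h , _ , refl) → ∣p∣≤n ⟨ h ⟩ }) (_ , g , self∈⟨⟩ g , refl) =
    ⟨ h ⟩ , ((h , λ _ → ∈⟨⟩⇔∈) , maximal) , λ x x∈g → Equivalence.from ∈⟨⟩⇔∈ (⟨⟩-trans x∈g g∈h)
    where
    maximal : ∀ C → IsCyclicSubgroup G C → ⟨ h ⟩ ⊆ C → C ⊆ ⟨ h ⟩
    maximal C (c , C≡⟨c⟩) ⟨h⟩⊆C {x} x∈C with x ∈? ⟨ h ⟩
    ... | yes x∈h = x∈h
    ... | no  x∉h = contradiction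
      (largest _ (c , Equivalence.to (C≡⟨c⟩ g) (⟨h⟩⊆C (Equivalence.from ∈⟨⟩⇔∈ g∈h)) , refl))
      (ℕ.<⇒≱ (p⊂q⇒∣p∣<∣q∣
        ( (λ {y} y∈h → Equivalence.from ∈⟨⟩⇔∈ (Equivalence.to (C≡⟨c⟩ y) (⟨h⟩⊆C y∈h)))
        , x , Equivalence.from ∈⟨⟩⇔∈ (Equivalence.to (C≡⟨c⟩ x) x∈C) , x∉h)))

  cyclic⇒coCyclic : ∀ {M x y} → IsCyclicSubgroup G M → x ∈ M → y ∈ M → CoCyclic x y
  cyclic⇒coCyclic {x = x} {y} (g , M≡⟨g⟩) x∈M y∈M =
    g , Equivalence.to (M≡⟨g⟩ x) x∈M , Equivalence.to (M≡⟨g⟩ y) y∈M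

  -- If `x` lies in a maximal M = ⟨g⟩, then `g` is co-cyclic with `x`, hence with `y`; a cyclic
  -- subgroup holding `y` and `g` contains M, so it equals M. Conversely, a cyclic subgroup holding
  -- `x` and `w` extends to a maximal one, which then also holds `y`.
  sameNbhd⇔sameMaxCyclics : ∀ {x y} → SameNbhd G x y ⇔ SameMaxCyclics G x y
  sameNbhd⇔sameMaxCyclics = mk⇔
    (λ same M M-max → mk⇔ (to same M M-max) (to (sameNbhd-sym same) M M-max))
    (λ same → Equivalence.from sameNbhd⇔ λ w →
      mk⇔ (from same) (from λ M M-max → ⇔-sym (same M M-max)))
    where
    to : ∀ {x y} → SameNbhd G x y → ∀ M → IsMaxCyclic G M → x ∈ M → y ∈ M
    to {x} {y} same M ((g , M≡⟨g⟩) , maximal) x∈M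
      with z , y∈z , g∈z ← Equivalence.to (Equivalence.to sameNbhd⇔ same g)
        (g , Equivalence.to (M≡⟨g⟩ x) x∈M , self∈⟨⟩ g) =
      maximal ⟨ z ⟩ (z , λ _ → ∈⟨⟩⇔∈)
        (λ {u} u∈M → Equivalence.from ∈⟨⟩⇔∈ (⟨⟩-trans (Equivalence.to (M≡⟨g⟩ u) u∈M) g∈z))
        (Equivalence.from ∈⟨⟩⇔∈ y∈z)
    from : ∀ {x y w} → SameMaxCyclics G x y → CoCyclic x w → CoCyclic y w
    from {x} {y} {w} same (z , x∈z , w∈z) with M , M-max , z⊆M ← cyclic⊆maximal z =
      cyclic⇒coCyclic (proj₁ M-max) (Equivalence.to (same M M-max) (z⊆M x x∈z)) (z⊆M w w∈z)

  -- Separated sets and class counts.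

  Separated : Subset n → Set
  Separated S = ∀ x y → x ∈ S → y ∈ S → x ≢ y → ¬ SameNbhd G x y

  separated? : ∀ S → Dec (Separated S)
  separated? S = all? λ x → all? λ y →
    x ∈? S →-dec (y ∈? S →-dec (¬? (x ≟ y) →-dec ¬? (sameNbhd? x y)))

  -- A form of `SeparatedSetValue` that finite search decides: a generator of any cyclic subgroup
  -- replaces the maximal one, and ≡ replaces equality of the sets of maximal cyclic subgroups.
  CyclicSeparatedValue : ℕ → Set
  CyclicSeparatedValue j =
    ∃[ S ] ((∃[ g ] (∀ x → x ∈ S → x ∈⟨ g ⟩)) × Separated S × card S ≡ j)

  cyclicSeparatedValue? : Decidable CyclicSeparatedValue
  cyclicSeparatedValue? j = anySubset? λ S →
    any? (λ g → all? λ x → x ∈? S →-dec x ∈⟨ g ⟩?) ×-dec separated? S ×-dec (card S ℕ.≟ j)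

  separatedSetValue⇔ : ∀ {j} → SeparatedSetValue G j ⇔ CyclicSeparatedValue j
  separatedSetValue⇔ = mk⇔
    (λ { (S , (M , ((g , M≡⟨g⟩) , _) , S⊆M) , sep , eq) →
      S , (g , λ x x∈S → Equivalence.to (M≡⟨g⟩ x) (S⊆M x∈S)) ,
      (λ x y x∈ y∈ x≢y → sep x y x∈ y∈ x≢y ∘ Equivalence.to sameNbhd⇔sameMaxCyclics) , eq })
    from
    where
    from : ∀ {j} → CyclicSeparatedValue j → SeparatedSetValue G j
    from (S , (g , S⊆⟨g⟩) , sep , eq) with M , M-max , g⊆M ← cyclic⊆maximal g =
      S , (M , M-max , λ {x} x∈S → g⊆M x (S⊆⟨g⟩ x x∈S)) ,
      (λ x y x∈ y∈ x≢y → sep x y x∈ y∈ x≢y ∘ Equivalence.from sameNbhd⇔sameMaxCyclics) , eq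

  classCountValue⇒separatedSetValue : ∀ {j} → ClassCountValue G j → SeparatedSetValue G j
  classCountValue⇒separatedSetValue (M , M-max , T , T⊆M , sep , _ , eq) =
    T , (M , M-max , T⊆M) ,
    (λ x y x∈ y∈ x≢y → sep x y x∈ y∈ x≢y ∘ Equivalence.from sameNbhd⇔sameMaxCyclics) , eq

  maxSeparatedSet : ∃ (IsMax (SeparatedSetValue G))
  maxSeparatedSet
    with m , m-value , m-max ← maximum cyclicSeparatedValue? n
      (λ { _ (S , _ , _ , refl) → ∣p∣≤n S })
      -- The empty set shows that some value is attained.
      (_ , ⊥ˢ , (ε , λ x x∈⊥ → contradiction x∈⊥ ∉⊥) , (λ x y x∈⊥ → contradiction x∈⊥ ∉⊥) , refl) =
    m , Equivalence.from separatedSetValue⇔ m-value ,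
    λ j v → m-max j (Equivalence.to separatedSetValue⇔ v)

  -- A largest separated set in M meets every class that meets M: an element of a missed class could
  -- be adjoined. It is therefore a transversal.
  maxSeparatedSet⇒classCount : ∀ {m} → IsMax (SeparatedSetValue G) m → ClassCountValue G m
  maxSeparatedSet⇒classCount ((S , (M , M-max , S⊆M) , sep , refl) , largest) =
    M , M-max , S , S⊆M , sep′ , meets , refl
    where
    sep′ : Separated S
    sep′ x y x∈ y∈ x≢y = sep x y x∈ y∈ x≢y ∘ Equivalence.to sameNbhd⇔sameMaxCyclics

    meets : ∀ x → x ∈ M → ∃[ t ] (t ∈ S × SameNbhd G x t)
    meets x x∈M with any? (λ t → t ∈? S ×-dec sameNbhd? x t)
    ... | yes found = found
    ... | no  none  = contradiction
      (largest _ (⁅ x ⁆ ∪ S , (M , M-max , extended⊆M) , extended-sep , refl))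
      (ℕ.<⇒≱ (p⊂q⇒∣p∣<∣q∣ (q⊆p∪q ⁅ x ⁆ S , x , x∈p∪q⁺ (inj₁ (x∈⁅x⁆ x)) , x∉S)))
      where
      x∉S : x ∉ S
      x∉S x∈S = none (x , x∈S , λ _ → ⇔-id _)
      new : ∀ {t} → t ∈ S → ¬ SameMaxCyclics G x t
      new t∈S same = none (_ , t∈S , Equivalence.from sameNbhd⇔sameMaxCyclics same)
      extended⊆M : ⁅ x ⁆ ∪ S ⊆ M
      extended⊆M y∈ with x∈p∪q⁻ ⁅ x ⁆ S y∈
      ... | inj₁ y∈x rewrite x∈⁅y⁆⇒x≡y x y∈x = x∈M
      ... | inj₂ y∈S = S⊆M y∈S
      extended-sep : ∀ y z → y ∈ ⁅ x ⁆ ∪ S → z ∈ ⁅ x ⁆ ∪ S → y ≢ z → ¬ SameMaxCyclics G y z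
      extended-sep y z y∈ z∈ y≢z same with x∈p∪q⁻ ⁅ x ⁆ S y∈ | x∈p∪q⁻ ⁅ x ⁆ S z∈
      ... | inj₁ y∈x | inj₁ z∈x = y≢z (trans (x∈⁅y⁆⇒x≡y x y∈x) (sym (x∈⁅y⁆⇒x≡y x z∈x)))
      ... | inj₁ y∈x | inj₂ z∈S rewrite x∈⁅y⁆⇒x≡y x y∈x = new z∈S same
      ... | inj₂ y∈S | inj₁ z∈x rewrite x∈⁅y⁆⇒x≡y x z∈x = new y∈S (λ M M-max → ⇔-sym (same M M-max))
      ... | inj₂ y∈S | inj₂ z∈S = sep y z y∈S z∈S y≢z same

  -- Distances and strong resolution.

  shortest-walk : ∀ x y → x ≢ y → ∃[ k ] (k ≤ 2 × ∃ λ (p : Walk G x y k) → IsShortest G p)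
  shortest-walk x y x≢y with coCyclic? x y
  ... | yes xy = 1 , s≤s z≤n , coCyclic⇒adj x≢y xy ∷ [] ,
    λ { [] → contradiction refl x≢y ; (_ ∷ _) → s≤s z≤n }
  -- Non-adjacent vertices are joined through `ε`, which differs from both because it is co-cyclic
  -- with everything.
  ... | no ¬xy = 2 , s≤s (s≤s z≤n) ,
    coCyclic⇒adj x≢ε (coCyclic-ε x) ∷ (coCyclic⇒adj ε≢y (coCyclic-sym (coCyclic-ε y)) ∷ []) ,
    λ { []            → contradiction refl x≢y
      ; (a ∷ [])      → contradiction (adj⇒coCyclic a) ¬xy
      ; (_ ∷ (_ ∷ _)) → s≤s (s≤s z≤n) }
    where
    x≢ε : x ≢ ε
    x≢ε refl = ¬xy (coCyclic-sym (coCyclic-ε y))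
    ε≢y : ε ≢ y
    ε≢y refl = ¬xy (coCyclic-ε x)

  stronglyResolves-sym : ∀ {z x y} → StronglyResolves G z x y → StronglyResolves G z y x
  stronglyResolves-sym (inj₁ r) = inj₂ r
  stronglyResolves-sym (inj₂ r) = inj₁ r

  self-resolves : ∀ x y → x ≢ y → StronglyResolves G x x y
  self-resolves x y x≢y with k , _ , p , shortest ← shortest-walk x y x≢y =
    inj₂ (k , p , shortest , here-start)

  -- The walk from `w` through `x` to `y` is shortest because `w` and `y` are neither equal nor
  -- adjacent.
  neighbour-resolves : ∀ {w x y} → x ≢ y → CoCyclic x y → CoCyclic x w → ¬ CoCyclic y w →
    StronglyResolves G w x y
  neighbour-resolves {w} {x} {y} x≢y xy xw ¬yw =
    inj₂ (2 , coCyclic⇒adj w≢x (coCyclic-sym xw) ∷ (coCyclic⇒adj x≢y xy ∷ []) ,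
      (λ { []            → contradiction (coCyclic-refl y) ¬yw
         ; (a ∷ [])      → contradiction (coCyclic-sym (adj⇒coCyclic a)) ¬yw
         ; (_ ∷ (_ ∷ _)) → s≤s (s≤s z≤n) }) ,
      there here-start)
    where
    w≢x : w ≢ x
    w≢x refl = ¬yw (coCyclic-sym xy)

  -- The graph has diameter at most two, so a shortest walk through y to x has middle vertex y.
  through⇒middle : ∀ {z x y k} (p : Walk G z x k) → IsShortest G p → OnWalk G y p →
    z ≢ x → z ≢ y → x ≢ y → CoCyclic x y × CoCyclic y z × ¬ CoCyclic x z
  through⇒middle []             _ _                  z≢x _ _ = contradiction refl z≢x
  through⇒middle _              _ here-start         _ z≢y _ = contradiction refl z≢y
  through⇒middle (_ ∷ [])       _ (there here-start) _ _ x≢y = contradiction refl x≢y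
  through⇒middle (_ ∷ (_ ∷ [])) _ (there (there here-start)) _ _ x≢y = contradiction refl x≢y
  through⇒middle (a ∷ (b ∷ [])) shortest (there here-start) z≢x _ _ =
    coCyclic-sym (adj⇒coCyclic b) , coCyclic-sym (adj⇒coCyclic a) ,
    λ xz → contradiction (shortest (coCyclic⇒adj z≢x (coCyclic-sym xz) ∷ [])) λ { (s≤s ()) }
  through⇒middle {z} {x} (_ ∷ (_ ∷ (_ ∷ _))) shortest _ z≢x _ _
    with k , k≤2 , p , _ ← shortest-walk z x z≢x =
    contradiction (ℕ.≤-trans (shortest p) k≤2) λ { (s≤s (s≤s ())) }

  -- The resolving vertex `z` is itself the witness: it is adjacent to the middle vertex of the
  -- shortest walk but not to the other end.
  resolves⇒separated : ∀ {z x y} → z ≢ x → z ≢ y → x ≢ y → StronglyResolves G z x y →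
    CoCyclic x y × ¬ SameNbhd G x y
  resolves⇒separated z≢x z≢y x≢y (inj₁ (k , p , shortest , on))
    with xy , yz , ¬xz ← through⇒middle p shortest on z≢x z≢y x≢y =
    xy , λ same → ¬xz (Equivalence.from (Equivalence.to sameNbhd⇔ same _) yz)
  resolves⇒separated z≢x z≢y x≢y (inj₂ r)
    with yx , ¬same ← resolves⇒separated z≢y z≢x (x≢y ∘ sym) (inj₁ r) =
    coCyclic-sym yx , ¬same ∘ sameNbhd-sym

  resolving⇒complement : ∀ {S} → IsStrongResolvingSet G S →
    ∀ x y → x ∈ ∁ S → y ∈ ∁ S → x ≢ y → CoCyclic x y × ¬ SameNbhd G x y
  resolving⇒complement {S} resolving x y x∈ y∈ x≢y with z , z∈S , r ← resolving x y x≢y =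
    resolves⇒separated (avoids x∈) (avoids y∈) x≢y r
    where
    avoids : ∀ {u} → u ∈ ∁ S → z ≢ u
    avoids u∈ refl = x∈∁p⇒x∉p u∈ z∈S

  -- A vertex outside `T` resolves every pair containing it. For two vertices of `T`, one that is
  -- co-cyclic with exactly one of them resolves the pair, and it lies outside `T` because `T` is a
  -- clique.
  complement-resolving : ∀ {T} → (∀ x y → x ∈ T → y ∈ T → CoCyclic x y) → Separated T →
    IsStrongResolvingSet G (∁ T)
  complement-resolving {T} clique sep x y x≢y with x ∈? T | y ∈? T
  ... | no x∉T  | _       = x , x∉p⇒x∈∁p x∉T , self-resolves x y x≢y
  ... | yes _   | no y∉T  =
    y , x∉p⇒x∈∁p y∉T , stronglyResolves-sym (self-resolves y x (x≢y ∘ sym))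
  ... | yes x∈T | yes y∈T = resolve (distinguish (sep x y x∈T y∈T x≢y))
    where
    resolve : ∃[ w ] ((CoCyclic x w × ¬ CoCyclic y w) ⊎ (CoCyclic y w × ¬ CoCyclic x w)) →
      ∃[ z ] (z ∈ ∁ T × StronglyResolves G z x y)
    resolve (w , inj₁ (xw , ¬yw)) =
      w , x∉p⇒x∈∁p (¬yw ∘ clique y w y∈T) , neighbour-resolves x≢y (clique x y x∈T y∈T) xw ¬yw
    resolve (w , inj₂ (yw , ¬xw)) =
      w , x∉p⇒x∈∁p (¬xw ∘ clique x w x∈T) ,
      stronglyResolves-sym (neighbour-resolves (x≢y ∘ sym) (clique y x y∈T x∈T) yw ¬xw)

  -- The complement of a largest separated set is strong resolving. Conversely, the complement of a
  -- strong resolving set is a clique of inequivalent vertices, so it lies in a cyclic subgroup and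
  -- has at most `m` elements.
  maxSeparatedSet⇒sdim : ∀ {m} → IsMax (SeparatedSetValue G) m → IsSdim G (n ∸ m)
  maxSeparatedSet⇒sdim {m} ((T , (M , M-max , T⊆M) , sep , refl) , largest) =
    (∁ T , complement-resolving
             (λ x y x∈ y∈ → cyclic⇒coCyclic (proj₁ M-max) (T⊆M x∈) (T⊆M y∈))
             (λ x y x∈ y∈ x≢y → sep x y x∈ y∈ x≢y ∘ Equivalence.to sameNbhd⇔sameMaxCyclics)
         , ∣∁p∣≡n∸∣p∣ T)
    , lower
    where
    lower : ∀ S → IsStrongResolvingSet G S → n ∸ m ≤ card S
    -- The size of `S` is rewritten as n minus the size of its complement, which is bounded by `m`.
    lower S resolving = subst (n ∸ m ≤_) (ℕ.m∸[m∸n]≡n (∣p∣≤n S)) (ℕ.∸-monoʳ-≤ n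
      (subst (_≤ m) (∣∁p∣≡n∸∣p∣ S) (largest _ (Equivalence.from separatedSetValue⇔
        (∁ S , clique⇒⊆⟨⟩ (∁ S) clique , (λ x y x∈ y∈ x≢y → proj₂ (apart x y x∈ y∈ x≢y)) , refl)))))
      where
      apart = resolving⇒complement resolving
      clique : ∀ x y → x ∈ ∁ S → y ∈ ∁ S → CoCyclic x y
      clique x y x∈ y∈ with x ≟ y
      ... | yes refl = coCyclic-refl x
      ... | no  x≢y  = proj₁ (apart x y x∈ y∈ x≢y)

theorem4p5 : (n : ℕ) (G : FinGroup n) →
    ∃[ m ] (IsMax (ClassCountValue G) m
    × IsMax (SeparatedSetValue G) m
    × IsSdim G (n ∸ m))
theorem4p5 n G = map₂
  (λ m-max →
    (maxSeparatedSet⇒classCount G m-max ,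
     λ j → proj₂ m-max j ∘ classCountValue⇒separatedSetValue G) ,
    m-max ,
    maxSeparatedSet⇒sdim G m-max)
  (maxSeparatedSet G)
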